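{- For all integers $n\ge 1$, $k\ge 0$ and $r,s$ with $0\le r<s\le n$, $$M_{r,s}^{n,k}=\sum_{i=0}^{k}\binom{k}{i}\left[\binom{n-k+i-1}{s-1}\binom{n-i-1}{n-r-1}-\binom{n-k+i-1}{s}\binom{n-i-1}{n-r}\right].$$
   Context: A lattice path of length $n$ here is a path in the plane starting at the origin $(0,0)$ and consisting of $n$ unit steps, each either E $=(1,0)$ or N $=(0,1)$. For integers $n\ge 1$, $k\ge 0$, $0\le r,s\le n$, let $M_{r,s}^{n,k}$ be the number of ordered pairs of lattice paths of length $n$ such that the first path ends at $(r,n-r)$, the second path ends at $(s,n-s)$, and the two paths intersect exactly $k$ times, where intersections at the origin and at the endpoints of the paths are not counted; that is, there are exactly $k$ indices $m$ with $1\le m\le n-1$ such that the two paths are at the same lattice point after $m$ steps. Binomial coefficients $\binom{a}{b}$ are $0$ unless $0\le b\le a$ (in particular they are $0$ when $a<0$). -}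

module Defs where

open import Data.Nat as ℕ using (ℕ; zero; suc; _∸_)
import Data.Nat.Properties as ℕ
open import Data.Nat.Combinatorics using (_C_)
open import Data.Integer as ℤ using (ℤ; +_; -[1+_]; 0ℤ)
open import Data.List using (List; []; _∷_; [_]; _++_; map; filter; foldl; foldr; length; take; upTo; cartesianProduct)
open import Data.List.Membership.Propositional using (_∈_)
open import Data.List.Membership.Propositional.Properties using (∈-map⁺; ∈-map⁻; ∈-++⁺ˡ; ∈-++⁺ʳ)
open import Data.List.Relation.Unary.All using ([])
open import Data.List.Relation.Unary.AllPairs using ([]; _∷_)
open import Data.List.Relation.Unary.Any using (here)
open import Data.List.Relation.Unary.Unique.Propositional using (Unique)
open import Data.List.Relation.Unary.Unique.Propositional.Properties using (map⁺; ++⁺)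
open import Data.Empty using (⊥)
open import Data.Product using (_×_; _,_; ∃)
open import Data.Product.Properties using (≡-dec)
open import Data.Vec using (Vec; []; _∷_; toList)
open import Data.Vec.Properties using (∷-injectiveʳ)
open import Relation.Binary.Definitions using (DecidableEquality)
open import Relation.Binary.PropositionalEquality using (_≡_; refl)
open import Relation.Nullary.Decidable using (_×-dec_)
open import Relation.Unary using (Pred; Decidable)
open import Level using (0ℓ)

-- East and north steps never leave the first quadrant, so coordinates are
-- taken in ℕ.
Point : Set
Point = ℕ × ℕ

_≟ₚ_ : DecidableEquality Point
_≟ₚ_ = ≡-dec ℕ._≟_ ℕ._≟_

data Step : Set where
  E N : Step

move : Point → Step → Point
move (x , y) E = suc x , y
move (x , y) N = x , suc y

Path : ℕ → Set
Path n = Vec Step n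

-- The point reached after the first m steps, for m ≤ n.
position : ∀ {n} → Path n → ℕ → Point
position p m = foldl move (0 , 0) (take m (toList p))

-- upTo (n ∸ 1) is 0, …, n ∸ 2, so m below ranges over 1, …, n ∸ 1.
intersections : ∀ {n} → Path n → Path n → ℕ
intersections {n} p q =
  length (filter (λ m → position p m ≟ₚ position q m) (map suc (upTo (n ∸ 1))))

allPaths : ∀ n → List (Path n)
allPaths zero    = [ [] ]
allPaths (suc n) = map (E ∷_) (allPaths n) ++ map (N ∷_) (allPaths n)

allPaths-complete : ∀ {n} (p : Path n) → p ∈ allPaths n
allPaths-complete []      = here refl
allPaths-complete (E ∷ p) = ∈-++⁺ˡ (∈-map⁺ (E ∷_) (allPaths-complete p))
allPaths-complete {suc n} (N ∷ p) =
  ∈-++⁺ʳ (map (E ∷_) (allPaths n)) (∈-map⁺ (N ∷_) (allPaths-complete p))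

allPaths-unique : ∀ n → Unique (allPaths n)
allPaths-unique zero    = [] ∷ []
allPaths-unique (suc n) =
  ++⁺ (map⁺ ∷-injectiveʳ (allPaths-unique n))
      (map⁺ ∷-injectiveʳ (allPaths-unique n))
      λ (e , f) → disjoint (∈-map⁻ (E ∷_) e) (∈-map⁻ (N ∷_) f)
  where
  disjoint : ∀ {v : Path (suc n)} →
             (∃ λ p → p ∈ allPaths n × v ≡ E ∷ p) →
             (∃ λ p → p ∈ allPaths n × v ≡ N ∷ p) → ⊥
  disjoint (_ , _ , refl) (_ , _ , ())

-- The truncated subtraction is exact for r , s ≤ n.
Counted : ∀ n (k r s : ℕ) → Pred (Path n × Path n) 0ℓ
Counted n k r s (p , q) =
  position p n ≡ (r , n ∸ r) × position q n ≡ (s , n ∸ s) × intersections p q ≡ k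

counted? : ∀ n k r s → Decidable (Counted n k r s)
counted? n k r s (p , q) =
  (position p n ≟ₚ (r , n ∸ r)) ×-dec
  (position q n ≟ₚ (s , n ∸ s)) ×-dec
  (intersections p q ℕ.≟ k)

M : (n k r s : ℕ) → ℕ
M n k r s = length (filter (counted? n k r s) (cartesianProduct (allPaths n) (allPaths n)))

-- Integer arguments are needed because upper entries such as n - i - 1 can be
-- negative; a C b is already 0 for natural numbers a < b.
binom : ℤ → ℤ → ℤ
binom (+ a)    (+ b)    = + (a C b)
binom (+ _)    -[1+ _ ] = 0ℤ
binom -[1+ _ ] _        = 0ℤ

-- ∑[0… k ] f = f 0 + f 1 + ⋯ + f k, with k included.
∑[0…_]_ : ℕ → (ℕ → ℤ) → ℤ
∑[0… k ] f = foldr ℤ._+_ 0ℤ (map f (upTo (suc k)))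

{-# OPTIONS --safe #-}
-- Let W n k r s count the pairs of paths with east counts r and s that meet k
-- times after the origin, a common endpoint included. Removing both last steps
-- gives W (n + 1) k = A (W n k) off the diagonal, where A multiplies generating
-- functions by (1 + x)(1 + y), and W (n + 1) (k + 1) = A (W n k) on it.
-- For k < n the right-hand side is a coefficient of (y - x) B ^ k A ^ (n - 1 - k)
-- with B = A - (y - x) = 1 + 2x + xy. This satisfies the first recursion trivially,
-- and the second because on the diagonal A and B act alike on W n k, which is
-- symmetric in r and s. The induction starts from W n n, which counts the pairs of
-- equal paths. For k ≥ n both sides vanish.
module Submission where

open import Defs
open import Data.Bool using (Bool; true; false; if_then_else_; _∧_)
open import Data.Nat as ℕ using (ℕ; zero; suc; _≤_; _<_; z≤n; s≤s; _∸_; _≡ᵇ_)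
open import Data.Nat.Combinatorics using (_C_; k>n⇒nCk≡0; nCk≡nC[n∸k]; nCk+nC[k+1]≡[n+1]C[k+1])
import Data.Nat.Properties as ℕ
open import Data.Integer using (ℤ; +_; -[1+_]; _+_; _-_; _*_; 0ℤ; 1ℤ)
open import Data.Integer.Properties
open import Data.Integer.Tactic.RingSolver using (solve-∀)
open import Data.List using (List; []; _∷_; [_]; _++_; map; foldr; foldl; filter; length; take; upTo; cartesianProduct)
open import Data.List.Properties using (map-upTo; map-applyUpTo; upTo-∷ʳ; map-++; map-∘; filter-++; length-++; foldl-∷ʳ; take-all)
open import Data.Product using (_,_; proj₁; proj₂)
open import Data.Sum using (_⊎_; inj₁; inj₂)
open import Data.Vec using ([]; _∷_; _∷ʳ_; toList)
open import Data.Vec.Properties using (toList-∷ʳ; length-toList)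
open import Function using (_∘_; id; _⇔_; mk⇔)
open import Level using (0ℓ)
open import Relation.Binary.PropositionalEquality using (_≡_; _≢_; refl; sym; trans; cong; cong₂; subst; module ≡-Reasoning)
open import Relation.Nullary using (Dec; yes; no; does; contradiction)
open import Relation.Nullary.Decidable using (does-⇔; dec-false; dec-true)
open import Relation.Unary using (Pred; Decidable)
open ≡-Reasoning

private variable
  I J : Set

-- Finite sums of integers.

sumOver : List I → (I → ℤ) → ℤ
sumOver xs f = foldr _+_ 0ℤ (map f xs)

sum-cong : ∀ (xs : List I) {f g} → (∀ i → f i ≡ g i) → sumOver xs f ≡ sumOver xs g
sum-cong []       eq = refl
sum-cong (x ∷ xs) eq = cong₂ _+_ (eq x) (sum-cong xs eq)

sum-zero : ∀ (xs : List I) → sumOver xs (λ _ → 0ℤ) ≡ 0ℤ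
sum-zero []       = refl
sum-zero (x ∷ xs) = trans (+-identityˡ _) (sum-zero xs)

+-interchange : ∀ a b c d → (a + b) + (c + d) ≡ (a + c) + (b + d)
+-interchange = solve-∀

+-congˡ : ∀ a {b c} → b ≡ c → a + b ≡ a + c
+-congˡ a = cong (λ u → a + u)

sum-+ : ∀ (xs : List I) f g → sumOver xs (λ i → f i + g i) ≡ sumOver xs f + sumOver xs g
sum-+ []       f g = refl
sum-+ (x ∷ xs) f g = 
  trans (+-congˡ (f x + g x) (sum-+ xs f g)) (+-interchange (f x) (g x) (sumOver xs f) (sumOver xs g))

sum-++ : ∀ (xs ys : List I) f → sumOver (xs ++ ys) f ≡ sumOver xs f + sumOver ys f
sum-++ []       ys f = sym (+-identityˡ _)
sum-++ (x ∷ xs) ys f = 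
  trans (+-congˡ (f x) (sum-++ xs ys f)) (sym (+-assoc (f x) (sumOver xs f) (sumOver ys f)))

sum-upTo-head : ∀ n f → sumOver (upTo (suc n)) f ≡ f 0 + sumOver (upTo n) (f ∘ suc)
sum-upTo-head n f = cong (λ ys → f 0 + foldr _+_ 0ℤ ys)
  (trans (map-applyUpTo suc f n) (sym (map-upTo (f ∘ suc) n)))

sum-upTo-last : ∀ n f → sumOver (upTo (suc n)) f ≡ sumOver (upTo n) f + f n
sum-upTo-last n f = begin
  sumOver (upTo (suc n)) f      ≡⟨ cong (λ xs → sumOver xs f) (upTo-∷ʳ n) ⟨
  sumOver (upTo n ++ [ n ]) f   ≡⟨ sum-++ (upTo n) [ n ] f ⟩
  sumOver (upTo n) f + (f n + 0ℤ) ≡⟨ +-congˡ (sumOver (upTo n) f) (+-identityʳ (f n)) ⟩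
  sumOver (upTo n) f + f n      ∎

sum-upTo-cong : ∀ n {f g} → (∀ i → i < n → f i ≡ g i) → sumOver (upTo n) f ≡ sumOver (upTo n) g
sum-upTo-cong zero    eq = refl
sum-upTo-cong (suc n) {f} {g} eq = begin
  sumOver (upTo (suc n)) f           ≡⟨ sum-upTo-head n f ⟩
  f 0 + sumOver (upTo n) (f ∘ suc)   ≡⟨ cong₂ _+_ (eq 0 (s≤s z≤n)) (sum-upTo-cong n (λ i i<n → eq (suc i) (s≤s i<n))) ⟩
  g 0 + sumOver (upTo n) (g ∘ suc)   ≡⟨ sum-upTo-head n g ⟨
  sumOver (upTo (suc n)) g           ∎

-- Power series and linear operators on them.

-- A function ℕ → ℤ stands for a power series in one variable, a function
-- ℕ → ℕ → ℤ for one in x and y; shift, X and Y multiply by the variable.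
shift : (ℕ → ℤ) → ℕ → ℤ
shift f zero    = 0ℤ
shift f (suc r) = f r

Series₂ : Set
Series₂ = ℕ → ℕ → ℤ

infixl 6 _⊕_
_⊕_ : (S T : Series₂ → Series₂) → Series₂ → Series₂
(S ⊕ T) f r s = S f r s + T f r s

X Y A B : Series₂ → Series₂
X f r s = shift (λ r′ → f r′ s) r
Y f r s = shift (f r) s
-- Multiplication by (1 + x)(1 + y) and by (1 + x)(1 + y) - (y - x) = 1 + 2x + xy.
A = id ⊕ X ⊕ Y ⊕ (Y ∘ X)
B = id ⊕ X ⊕ X ⊕ (Y ∘ X)

-- Series are compared coefficient by coefficient, so invariance under pointwise equality has to be
-- a field. `null` is the empty case of `sum`.
record IsLinear (T : Series₂ → Series₂) : Set where
  field
    ext   : ∀ {f g} → (∀ r s → f r s ≡ g r s) → ∀ r s → T f r s ≡ T g r s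
    add   : ∀ f g r s → T (λ r s → f r s + g r s) r s ≡ T f r s + T g r s
    scale : ∀ c f r s → T (λ r s → c * f r s) r s ≡ c * T f r s
    null  : ∀ r s → T (λ _ _ → 0ℤ) r s ≡ 0ℤ

  sum : ∀ (xs : List I) (f : I → Series₂) r s →
        T (λ r s → sumOver xs (λ i → f i r s)) r s ≡ sumOver xs (λ i → T (f i) r s)
  sum []       f r s = null r s
  sum (x ∷ xs) f r s =
    trans (add (f x) (λ r s → sumOver xs (λ i → f i r s)) r s) (+-congˡ (T (f x) r s) (sum xs f r s))

  combination : ∀ (xs : List I) (c : I → ℤ) (f : I → Series₂) r s →
        T (λ r s → sumOver xs (λ i → c i * f i r s)) r s ≡ sumOver xs (λ i → c i * T (f i) r s)
  combination xs c f r s =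
    trans (sum xs (λ i r s → c i * f i r s) r s) (sum-cong xs (λ i → scale (c i) (f i) r s))

id-linear : IsLinear id
id-linear = record
  { ext   = id
  ; add   = λ _ _ _ _ → refl
  ; scale = λ _ _ _ _ → refl
  ; null  = λ _ _ → refl
  }

X-linear : IsLinear X
X-linear = record
  { ext   = λ { eq zero s → refl ; eq (suc r) s → eq r s }
  ; add   = λ { f g zero s → refl ; f g (suc r) s → refl }
  ; scale = λ { c f zero s → sym (*-zeroʳ c) ; c f (suc r) s → refl }
  ; null  = λ { zero s → refl ; (suc r) s → refl }
  }

Y-linear : IsLinear Y
Y-linear = record
  { ext   = λ { eq r zero → refl ; eq r (suc s) → eq r s }
  ; add   = λ { f g r zero → refl ; f g r (suc s) → refl }
  ; scale = λ { c f r zero → sym (*-zeroʳ c) ; c f r (suc s) → refl }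
  ; null  = λ { r zero → refl ; r (suc s) → refl }
  }

⊕-linear : ∀ {S T} → IsLinear S → IsLinear T → IsLinear (S ⊕ T)
⊕-linear {S} {T} lin-S lin-T = record
  { ext   = λ eq r s → cong₂ _+_ (S.ext eq r s) (T.ext eq r s)
  ; add   = λ f g r s → trans (cong₂ _+_ (S.add f g r s) (T.add f g r s)) 
      (+-interchange (S f r s) (S g r s) (T f r s) (T g r s))
  ; scale = λ c f r s → trans (cong₂ _+_ (S.scale c f r s) (T.scale c f r s)) 
      (sym (*-distribˡ-+ c (S f r s) (T f r s)))
  ; null  = λ r s → cong₂ _+_ (S.null r s) (T.null r s)
  }
  where
  module S = IsLinear lin-S
  module T = IsLinear lin-T

∘-linear : ∀ {S T} → IsLinear S → IsLinear T → IsLinear (S ∘ T)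
∘-linear lin-S lin-T = record
  { ext   = λ eq → S.ext (T.ext eq)
  ; add   = λ f g r s → trans (S.ext (T.add f g) r s) (S.add _ _ r s)
  ; scale = λ c f r s → trans (S.ext (T.scale c f) r s) (S.scale c _ r s)
  ; null  = λ r s → trans (S.ext T.null r s) (S.null r s)
  }
  where
  module S = IsLinear lin-S
  module T = IsLinear lin-T

module A = IsLinear (⊕-linear (⊕-linear (⊕-linear id-linear X-linear) Y-linear) (∘-linear Y-linear X-linear))
module B = IsLinear (⊕-linear (⊕-linear (⊕-linear id-linear X-linear) X-linear) (∘-linear Y-linear X-linear))
module Y = IsLinear Y-linear

-- Binomial powers and their products with y - x.

pow : ℕ → ℕ → ℤ
pow a r = + (a C r)

pow-suc : ∀ a r → pow (suc a) r ≡ pow a r + shift (pow a) r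
pow-suc a zero    = refl
pow-suc a (suc r) = trans (cong +_ (sym (nCk+nC[k+1]≡[n+1]C[k+1] a r))) (+-comm (pow a r) (pow a (suc r)))

-- x ^ i (1 + x) ^ b.
mono : ℕ → ℕ → ℕ → ℤ
mono zero    b = pow b
mono (suc i) b = shift (mono i b)

mono-suc : ∀ i b r → mono i (suc b) r ≡ mono i b r + mono (suc i) b r
mono-suc zero    b r       = pow-suc b r
mono-suc (suc i) b zero    = refl
mono-suc (suc i) b (suc r) = mono-suc i b r

-- (y - x) x ^ i (1 + y) ^ a (1 + x) ^ b.
term : (i a b : ℕ) → Series₂
term i a b r s = shift (pow a) s * mono i b r - pow a s * mono (suc i) b r

X-term : ∀ i a b r s → X (term i a b) r s ≡ term (suc i) a b r s
X-term i a b zero    s = zeros (shift (pow a) s) (pow a s)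
  where
  zeros : ∀ u v → 0ℤ ≡ u * 0ℤ - v * 0ℤ
  zeros = solve-∀
X-term i a b (suc r) s = refl

term-sucʸ : ∀ i a b r s → term i (suc a) b r s ≡ term i a b r s + Y (term i a b) r s
term-sucʸ i a b r zero    = sym (+-identityʳ _)
term-sucʸ i a b r (suc s) = trans
  (cong₂ (λ u v → u * mono i b r - v * mono (suc i) b r) (pow-suc a s) (pow-suc a (suc s)))
  (regroup (pow a s) (shift (pow a) s) (pow a (suc s)) (mono i b r) (mono (suc i) b r))
  where
  regroup : ∀ p p′ q m m′ → (p + p′) * m - (q + p) * m′ ≡ (p * m - q * m′) + (p′ * m - p * m′)
  regroup = solve-∀

term-sucˣ : ∀ i a b r s → term i a (suc b) r s ≡ term i a b r s + X (term i a b) r s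
term-sucˣ i a b r s = begin
  term i a (suc b) r s
    ≡⟨ cong₂ (λ u v → shift (pow a) s * u - pow a s * v) (mono-suc i b r) (mono-suc (suc i) b r) ⟩
  shift (pow a) s * (mono i b r + mono (suc i) b r) - pow a s * (mono (suc i) b r + mono (suc (suc i)) b r)
    ≡⟨ regroup (shift (pow a) s) (pow a s) (mono i b r) (mono (suc i) b r) _ ⟩
  term i a b r s + term (suc i) a b r s
    ≡⟨ +-congˡ (term i a b r s) (X-term i a b r s) ⟨
  term i a b r s + X (term i a b) r s ∎
  where
  regroup : ∀ p q m m′ m″ → p * (m + m′) - q * (m′ + m″) ≡ (p * m - q * m′) + (p * m′ - q * m″)
  regroup = solve-∀

-- `term-sucʸ` supplies a factor 1 + y and `term-sucˣ` a factor 1 + x; expanding the product gives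
-- the four summands of `A`.
term-A : ∀ i a b r s → term i (suc a) (suc b) r s ≡ A (term i a b) r s
term-A i a b r s = begin
  term i (suc a) (suc b) r s
    ≡⟨ term-sucʸ i a (suc b) r s ⟩
  term i a (suc b) r s + Y (term i a (suc b)) r s
    ≡⟨ cong₂ _+_ (term-sucˣ i a b r s)
         (trans (Y.ext (term-sucˣ i a b) r s) (Y.add (term i a b) (X (term i a b)) r s)) ⟩
  (term i a b r s + X (term i a b) r s) + (Y (term i a b) r s + Y (X (term i a b)) r s)
    ≡⟨ +-assoc (term i a b r s + X (term i a b) r s) _ _ ⟨
  A (term i a b) r s ∎

-- B splits as (1 + x) + x (1 + y). The first part raises b, the second raises i and a, so expanding
-- B ^ k binomially stays within the family `term`.
term-B : ∀ i a b r s → term i a (suc b) r s + term (suc i) (suc a) b r s ≡ B (term i a b) r s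
term-B i a b r s = begin
  term i a (suc b) r s + term (suc i) (suc a) b r s
    ≡⟨ cong₂ _+_ (term-sucˣ i a b r s) (term-sucʸ (suc i) a b r s) ⟩
  (term i a b r s + X (term i a b) r s) + (term (suc i) a b r s + Y (term (suc i) a b) r s)
    ≡⟨ cong₂ (λ u v → (term i a b r s + X (term i a b) r s) + (u + v))
         (X-term i a b r s) (Y.ext (X-term i a b) r s) ⟨
  (term i a b r s + X (term i a b) r s) + (X (term i a b) r s + Y (X (term i a b)) r s)
    ≡⟨ +-assoc (term i a b r s + X (term i a b) r s) _ _ ⟨
  B (term i a b) r s ∎

-- The series (y - x) B ^ k A ^ m.

-- One step of the binomial theorem: Pascal's rule splits each coefficient, and reindexing the
-- second half pairs `h i` with `h (suc i)`.
binomial-sum-suc : ∀ k (h : ℕ → ℤ) →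
  sumOver (upTo (suc (suc k))) (λ i → pow (suc k) i * h i) ≡
  sumOver (upTo (suc k)) (λ i → pow k i * (h i + h (suc i)))
binomial-sum-suc k h = begin
  sumOver (upTo (suc (suc k))) (λ i → pow (suc k) i * h i)
    ≡⟨ sum-cong (upTo (suc (suc k))) (λ i →
         trans (cong (λ c → c * h i) (pow-suc k i)) (*-distribʳ-+ (h i) (pow k i) (shift (pow k) i))) ⟩
  sumOver (upTo (suc (suc k))) (λ i → keep i + skip i)
    ≡⟨ sum-+ (upTo (suc (suc k))) keep skip ⟩
  sumOver (upTo (suc (suc k))) keep + sumOver (upTo (suc (suc k))) skip
    ≡⟨ cong₂ _+_ (sum-upTo-last (suc k) keep) (sum-upTo-head (suc k) skip) ⟩
  (S + pow k (suc k) * h (suc k)) + (0ℤ * h 0 + S′)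
    -- The two boundary terms vanish: k over k + 1 is zero, and `shift` is zero at 0.
    ≡⟨ cong (λ c → (S + + c * h (suc k)) + (0ℤ * h 0 + S′)) (k>n⇒nCk≡0 (ℕ.n<1+n k)) ⟩
  (S + 0ℤ * h (suc k)) + (0ℤ * h 0 + S′)
    ≡⟨ zeros S S′ (h (suc k)) (h 0) ⟩
  S + S′
    ≡⟨ sum-+ (upTo (suc k)) keep (skip ∘ suc) ⟨
  sumOver (upTo (suc k)) (λ i → keep i + skip (suc i))
    ≡⟨ sum-cong (upTo (suc k)) (λ i → *-distribˡ-+ (pow k i) (h i) (h (suc i))) ⟨
  sumOver (upTo (suc k)) (λ i → pow k i * (h i + h (suc i))) ∎
  where
  keep skip : ℕ → ℤ
  keep i = pow k i * h i
  skip i = shift (pow k) i * h i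
  S S′ : ℤ
  S  = sumOver (upTo (suc k)) keep
  S′ = sumOver (upTo (suc k)) (skip ∘ suc)
  zeros : ∀ u v p q → (u + 0ℤ * p) + (0ℤ * q + v) ≡ u + v
  zeros = solve-∀

-- Coefficients of (y - x) B ^ k A ^ m, expanded by the binomial theorem.
Q : (m k : ℕ) → Series₂
Q m k r s = sumOver (upTo (suc k)) (λ i → pow k i * term i (m ℕ.+ i) (m ℕ.+ (k ∸ i)) r s)

Q-A : ∀ m k r s → Q (suc m) k r s ≡ A (Q m k) r s
Q-A m k r s = begin
  Q (suc m) k r s
    ≡⟨ sum-cong (upTo (suc k)) (λ i → cong (pow k i *_) (term-A i (m ℕ.+ i) (m ℕ.+ (k ∸ i)) r s)) ⟩
  sumOver (upTo (suc k)) (λ i → pow k i * A (term i (m ℕ.+ i) (m ℕ.+ (k ∸ i))) r s)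
    ≡⟨ A.combination (upTo (suc k)) (pow k) (λ i → term i (m ℕ.+ i) (m ℕ.+ (k ∸ i))) r s ⟨
  A (Q m k) r s ∎

Q-B : ∀ m k r s → Q m (suc k) r s ≡ B (Q m k) r s
Q-B m k r s = begin
  Q m (suc k) r s
    ≡⟨ binomial-sum-suc k (λ i → term i (m ℕ.+ i) (m ℕ.+ (suc k ∸ i)) r s) ⟩
  sumOver (upTo (suc k)) (λ i → pow k i *
      (term i (m ℕ.+ i) (m ℕ.+ (suc k ∸ i)) r s + term (suc i) (m ℕ.+ suc i) (m ℕ.+ (k ∸ i)) r s))
    -- The bound i ≤ k makes `suc k ∸ i` equal to `suc (k ∸ i)`, as `term-B` requires.
    ≡⟨ sum-upTo-cong (suc k) (λ { i (s≤s i≤k) → cong (pow k i *_) (summand i i≤k) }) ⟩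
  sumOver (upTo (suc k)) (λ i → pow k i * B (term i (m ℕ.+ i) (m ℕ.+ (k ∸ i))) r s)
    ≡⟨ B.combination (upTo (suc k)) (pow k) (λ i → term i (m ℕ.+ i) (m ℕ.+ (k ∸ i))) r s ⟨
  B (Q m k) r s ∎
  where
  summand : ∀ i → i ≤ k →
    term i (m ℕ.+ i) (m ℕ.+ (suc k ∸ i)) r s + term (suc i) (m ℕ.+ suc i) (m ℕ.+ (k ∸ i)) r s ≡
    B (term i (m ℕ.+ i) (m ℕ.+ (k ∸ i))) r s
  summand i i≤k = trans
    (cong₂ (λ b a → term i (m ℕ.+ i) b r s + term (suc i) a (m ℕ.+ (k ∸ i)) r s)
      (trans (cong (m ℕ.+_) (ℕ.+-∸-assoc 1 i≤k)) (ℕ.+-suc m (k ∸ i))) (ℕ.+-suc m i))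
    (term-B i (m ℕ.+ i) (m ℕ.+ (k ∸ i)) r s)

-- For k = 0 the series is (y - x) A ^ m, which is antisymmetric in x and y.
Q-diagonal : ∀ m r → Q m 0 r r ≡ 0ℤ
Q-diagonal m r = begin
  pow 0 0 * term 0 (m ℕ.+ 0) (m ℕ.+ 0) r r + 0ℤ ≡⟨ cancel (shift (pow (m ℕ.+ 0)) r) (pow (m ℕ.+ 0) r) ⟩
  0ℤ ∎
  where
  cancel : ∀ u v → 1ℤ * (u * v - v * u) + 0ℤ ≡ 0ℤ
  cancel = solve-∀

-- In every monomial of B = 1 + 2x + xy the degree in y is at most that in x, so the factor y - x
-- brings s to at most r + 1.
Q-far : ∀ k r s → suc r < s → Q 0 k r s ≡ 0ℤ
Q-far zero    r       (suc zero)    (s≤s ())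
Q-far zero    zero    (suc (suc s)) _ = refl
Q-far zero    (suc r) (suc (suc s)) _ = refl
Q-far (suc k) zero    (suc s) p = trans (Q-B 0 k 0 (suc s))
  (cong (λ u → u + 0ℤ + 0ℤ + 0ℤ) (Q-far k 0 (suc s) p))
Q-far (suc k) (suc r) (suc s) p = trans (Q-B 0 k (suc r) (suc s))
  (cong₂ _+_ (cong₂ _+_ (cong₂ _+_ (Q-far k (suc r) (suc s) p) far) far) (Q-far k r s (ℕ.s≤s⁻¹ p)))
  where
  far : Q 0 k r (suc s) ≡ 0ℤ
  far = Q-far k r (suc s) (ℕ.m≤n⇒m≤1+n (ℕ.s≤s⁻¹ p))

-- On the line s = r + 1 only the y of y - x and the monomials 1 and xy of B contribute, which
-- leaves the coefficient of (xy) ^ r in (1 + xy) ^ k.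
Q-near : ∀ k r → Q 0 k r (suc r) ≡ pow k r
Q-near zero    zero    = refl
Q-near zero    (suc r) = refl
Q-near (suc k) zero    = trans (Q-B 0 k 0 1) (cong (λ u → u + 0ℤ + 0ℤ + 0ℤ) (Q-near k 0))
Q-near (suc k) (suc r) = begin
  Q 0 (suc k) (suc r) (suc (suc r))
    ≡⟨ Q-B 0 k (suc r) (suc (suc r)) ⟩
  Q 0 k (suc r) (suc (suc r)) + Q 0 k r (suc (suc r)) + Q 0 k r (suc (suc r)) + Q 0 k r (suc r)
    ≡⟨ cong₂ _+_ (cong₂ _+_ (cong₂ _+_ (Q-near k (suc r)) far) far) (Q-near k r) ⟩
  pow k (suc r) + 0ℤ + 0ℤ + pow k r
    ≡⟨ cong (_+ pow k r) (trans (+-identityʳ (pow k (suc r) + 0ℤ)) (+-identityʳ (pow k (suc r)))) ⟩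
  pow k (suc r) + pow k r
    ≡⟨ pow-suc k (suc r) ⟨
  pow (suc k) (suc r) ∎
  where
  far : Q 0 k r (suc (suc r)) ≡ 0ℤ
  far = Q-far k r (suc (suc r)) ℕ.≤-refl

-- Counting by sums of indicators over paths.

indicator : Bool → ℤ
indicator b = if b then 1ℤ else 0ℤ

sum-map : ∀ (g : I → J) xs f → sumOver (map g xs) f ≡ sumOver xs (f ∘ g)
sum-map g xs f = cong (foldr _+_ 0ℤ) (sym (map-∘ xs))

length-filter : ∀ {P : Pred I 0ℓ} (P? : Decidable P) xs →
  + length (filter P? xs) ≡ sumOver xs (λ x → indicator (does (P? x)))
length-filter P? []       = refl
length-filter P? (x ∷ xs) with does (P? x)
... | true  = +-congˡ 1ℤ (length-filter P? xs)
... | false = trans (length-filter P? xs) (sym (+-identityˡ _))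

sum-cartesianProduct : ∀ (xs : List I) (ys : List J) f →
  sumOver (cartesianProduct xs ys) f ≡ sumOver xs (λ x → sumOver ys (λ y → f (x , y)))
sum-cartesianProduct []       ys f = refl
sum-cartesianProduct (x ∷ xs) ys f = trans (sum-++ (map (x ,_) ys) (cartesianProduct xs ys) f)
  (cong₂ _+_ (sum-map (x ,_) ys f) (sum-cartesianProduct xs ys f))

sum-allPaths-cons : ∀ n f →
  sumOver (allPaths (suc n)) f ≡ sumOver (allPaths n) (f ∘ (E ∷_)) + sumOver (allPaths n) (f ∘ (N ∷_))
sum-allPaths-cons n f = trans (sum-++ (map (E ∷_) (allPaths n)) (map (N ∷_) (allPaths n)) f)
  (cong₂ _+_ (sum-map (E ∷_) (allPaths n) f) (sum-map (N ∷_) (allPaths n) f))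

-- `allPaths` branches on the first step, while the recursion for `W` removes the last one.
-- Prepending and appending commute, so induction passes from one to the other.
sum-allPaths-snoc : ∀ n f →
  sumOver (allPaths (suc n)) f ≡ sumOver (allPaths n) (λ p → f (p ∷ʳ E) + f (p ∷ʳ N))
sum-allPaths-snoc zero    f = sym (+-assoc (f (E ∷ [])) (f (N ∷ [])) 0ℤ)
sum-allPaths-snoc (suc n) f = begin
  sumOver (allPaths (suc (suc n))) f
    ≡⟨ sum-allPaths-cons (suc n) f ⟩
  sumOver (allPaths (suc n)) (f ∘ (E ∷_)) + sumOver (allPaths (suc n)) (f ∘ (N ∷_))
    ≡⟨ cong₂ _+_ (sum-allPaths-snoc n (f ∘ (E ∷_))) (sum-allPaths-snoc n (f ∘ (N ∷_))) ⟩
  sumOver (allPaths n) (g ∘ (E ∷_)) + sumOver (allPaths n) (g ∘ (N ∷_))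
    ≡⟨ sum-allPaths-cons n g ⟨
  sumOver (allPaths (suc n)) g ∎
  where
  g : Path (suc n) → ℤ
  g p = f (p ∷ʳ E) + f (p ∷ʳ N)

-- Eastings and meetings of paths.

eastings : ∀ {n} → Path n → ℕ → ℕ
eastings p m = proj₁ (position p m)

take-length-++ : ∀ m (xs ys : List I) → m ≤ length xs → take m (xs ++ ys) ≡ take m xs
take-length-++ zero    xs       ys _         = refl
take-length-++ (suc m) (x ∷ xs) ys (s≤s m≤n) = cong (x ∷_) (take-length-++ m xs ys m≤n)

position-∷ʳ : ∀ {n} (p : Path n) x m → m ≤ n → position (p ∷ʳ x) m ≡ position p m
position-∷ʳ {n} p x m m≤n = cong (foldl move (0 , 0)) (begin
  take m (toList (p ∷ʳ x))      ≡⟨ cong (take m) (toList-∷ʳ x p) ⟩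
  take m (toList p ++ [ x ])    ≡⟨ take-length-++ m (toList p) [ x ] (subst (m ≤_) (sym (length-toList p)) m≤n) ⟩
  take m (toList p)             ∎)

position-all : ∀ {n} (p : Path n) → position p n ≡ foldl move (0 , 0) (toList p)
position-all {n} p = cong (foldl move (0 , 0)) (take-all n (toList p) (ℕ.≤-reflexive (length-toList p)))

position-last : ∀ {n} (p : Path n) x → position (p ∷ʳ x) (suc n) ≡ move (position p n) x
position-last {n} p x = begin
  position (p ∷ʳ x) (suc n)                 ≡⟨ position-all (p ∷ʳ x) ⟩
  foldl move (0 , 0) (toList (p ∷ʳ x))      ≡⟨ cong (foldl move (0 , 0)) (toList-∷ʳ x p) ⟩
  foldl move (0 , 0) (toList p ++ [ x ])    ≡⟨ foldl-∷ʳ move (0 , 0) x (toList p) ⟩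
  move (foldl move (0 , 0) (toList p)) x    ≡⟨ cong (λ z → move z x) (position-all p) ⟨
  move (position p n) x                     ∎

-- Each step raises the coordinate sum by one, so after m steps the easting determines the point.
-- Endpoints and meetings can then be tested on eastings alone.
northings : ∀ {n} (p : Path n) m → m ≤ n → proj₂ (position p m) ≡ m ∸ eastings p m
northings p m m≤n = sym (trans (cong (_∸ eastings p m) (sym (total p m m≤n)))
                              (ℕ.m+n∸m≡n (eastings p m) _))
  where
  -- The starting point z is arbitrary because the induction moves it at each step.
  steps : ∀ {n} (p : Path n) z m → m ≤ n →
    let (x , y) = foldl move z (take m (toList p)) in x ℕ.+ y ≡ (proj₁ z ℕ.+ proj₂ z) ℕ.+ m
  steps p       (x , y) zero    _         = sym (ℕ.+-identityʳ _)
  steps (E ∷ p) (x , y) (suc m) (s≤s m≤n) = trans (steps p (suc x , y) m m≤n) (sym (ℕ.+-suc (x ℕ.+ y) m))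
  steps (N ∷ p) (x , y) (suc m) (s≤s m≤n) = trans (steps p (x , suc y) m m≤n)
    (trans (cong (ℕ._+ m) (ℕ.+-suc x y)) (sym (ℕ.+-suc (x ℕ.+ y) m)))
  total : ∀ {n} (p : Path n) m → m ≤ n → eastings p m ℕ.+ proj₂ (position p m) ≡ m
  total p m m≤n = steps p (0 , 0) m m≤n

position≡ : ∀ {n} (p : Path n) m x → m ≤ n → position p m ≡ (x , m ∸ x) ⇔ eastings p m ≡ x
position≡ p m x m≤n = mk⇔ (cong proj₁)
  (λ eq → cong₂ _,_ eq (trans (northings p m m≤n) (cong (m ∸_) eq)))

positions≡ : ∀ {n} (p q : Path n) m → m ≤ n → position p m ≡ position q m ⇔ eastings p m ≡ eastings q m
positions≡ p q m m≤n = mk⇔ (cong proj₁)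
  (λ eq → cong₂ _,_ eq (trans (northings p m m≤n) (trans (cong (m ∸_) eq) (sym (northings q m m≤n)))))

-- `a ≡ᵇ b` is what `does (a ℕ.≟ b)` computes to, so facts about the decision procedure apply
-- directly.
bump : (a b j : ℕ) → ℕ
bump a b j = if a ≡ᵇ b then suc j else j

meetings : ∀ {n} → Path n → Path n → ℕ → ℕ
meetings p q zero    = 0
meetings p q (suc m) = bump (eastings p (suc m)) (eastings q (suc m)) (meetings p q m)

-- `meetings` grows at its last index, so the induction splits `upTo` at the end instead of the
-- head.
meetings-filter : ∀ {n} (p q : Path n) m → m ≤ n →
  length (filter (λ m → position p m ≟ₚ position q m) (map suc (upTo m))) ≡ meetings p q m
meetings-filter p q zero    _   = refl
meetings-filter p q (suc m) m<n = begin
  length (filter P? (map suc (upTo (suc m))))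
    ≡⟨ cong (length ∘ filter P? ∘ map suc) (upTo-∷ʳ m) ⟨
  length (filter P? (map suc (upTo m ++ [ m ])))
    ≡⟨ cong (length ∘ filter P?) (map-++ suc (upTo m) [ m ]) ⟩
  length (filter P? (map suc (upTo m) ++ [ suc m ]))
    ≡⟨ cong length (filter-++ P? (map suc (upTo m)) [ suc m ]) ⟩
  length (filter P? (map suc (upTo m)) ++ filter P? [ suc m ])
    ≡⟨ length-++ (filter P? (map suc (upTo m))) ⟩
  length (filter P? (map suc (upTo m))) ℕ.+ length (filter P? [ suc m ])
    ≡⟨ cong (ℕ._+ length (filter P? [ suc m ])) (meetings-filter p q m (ℕ.<⇒≤ m<n)) ⟩
  meetings p q m ℕ.+ length (filter P? [ suc m ])
    ≡⟨ last (eastings p (suc m) ≡ᵇ eastings q (suc m))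
         (does-⇔ (positions≡ p q (suc m) m<n) (P? (suc m)) (eastings p (suc m) ℕ.≟ eastings q (suc m))) ⟩
  meetings p q (suc m) ∎
  where
  P? : ∀ m → Dec (position p m ≡ position q m)
  P? m = position p m ≟ₚ position q m
  last : ∀ b → does (P? (suc m)) ≡ b → meetings p q m ℕ.+ length (filter P? [ suc m ]) ≡
         (if b then suc (meetings p q m) else meetings p q m)
  last b eq with does (P? (suc m))
  last true  refl | true  = ℕ.+-comm (meetings p q m) 1
  last false refl | false = ℕ.+-identityʳ (meetings p q m)

meetings-∷ʳ : ∀ {n} (p q : Path n) x y m → m ≤ n → meetings (p ∷ʳ x) (q ∷ʳ y) m ≡ meetings p q m
meetings-∷ʳ p q x y zero    _   = refl
meetings-∷ʳ p q x y (suc m) m<n = trans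
  (cong (bump (eastings (p ∷ʳ x) (suc m)) (eastings (q ∷ʳ y) (suc m))) (meetings-∷ʳ p q x y m (ℕ.<⇒≤ m<n)))
  (cong₂ (λ a b → bump a b (meetings p q m))
    (cong proj₁ (position-∷ʳ p x (suc m) m<n)) (cong proj₁ (position-∷ʳ q y (suc m) m<n)))

-- The recursion for W.

δ : ℕ → ℕ → ℤ
δ a r = indicator (a ≡ᵇ r)

δ-subst : ∀ (f : ℕ → ℤ) a r → δ a r * f a ≡ δ a r * f r
δ-subst f zero    zero    = refl
δ-subst f zero    (suc r) = refl
δ-subst f (suc a) zero    = refl
δ-subst f (suc a) (suc r) = δ-subst (f ∘ suc) a r

-- Unlike in Defs, a common endpoint counts as a meeting; this makes removing the
-- last step of both paths a recursion.
W[_] : (ℕ → ℤ) → ℕ → Series₂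
W[ g ] n r s = sumOver (allPaths n) λ p → sumOver (allPaths n) λ q →
  δ (eastings p n) r * (δ (eastings q n) s * g (meetings p q n))

W : (n k : ℕ) → Series₂
W n k = W[ (λ j → δ j k) ] n

-- The four choices of last steps raise each easting by 0 or 1 and so match the monomials 1, x, y
-- and xy of A.
step-sum : ∀ (g : ℕ → ℤ) {n} (p q : Path n) r s →
  let f = λ (p q : Path (suc n)) → δ (eastings p (suc n)) r * (δ (eastings q (suc n)) s * g (meetings p q (suc n)))
  in (f (p ∷ʳ E) (q ∷ʳ E) + f (p ∷ʳ E) (q ∷ʳ N)) + (f (p ∷ʳ N) (q ∷ʳ E) + f (p ∷ʳ N) (q ∷ʳ N)) ≡
     A (λ r′ s′ → δ (eastings p n) r′ * (δ (eastings q n) s′ * g (bump r s (meetings p q n)))) r s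
step-sum g {n} p q r s = begin
  (f E E + f E N) + (f N E + f N N)
    ≡⟨ cong₂ _+_ (cong₂ _+_ (last E E) (last E N)) (cong₂ _+_ (last N E) (last N N)) ⟩
  (h (suc a) (suc b) + h (suc a) b) + (h a (suc b) + h a b)
    ≡⟨ regroup (h (suc a) (suc b)) (h (suc a) b) (h a (suc b)) (h a b) ⟩
  h a b + h (suc a) b + h a (suc b) + h (suc a) (suc b)
    ≡⟨ cong₂ _+_ (cong₂ _+_ (+-congˡ (h a b) (X-δ r)) (Y-δ s)) (YX-δ r s) ⟩
  A (λ r′ s′ → δ a r′ * (δ b s′ * c)) r s ∎
  where
  a b : ℕ
  a = eastings p n
  b = eastings q n
  c : ℤ
  c = g (bump r s (meetings p q n))
  f : Step → Step → ℤ
  f x y = δ (eastings (p ∷ʳ x) (suc n)) r * (δ (eastings (q ∷ʳ y) (suc n)) s * g (meetings (p ∷ʳ x) (q ∷ʳ y) (suc n)))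
  h : ℕ → ℕ → ℤ
  h a b = δ a r * (δ b s * c)
  regroup : ∀ a b c d → (a + b) + (c + d) ≡ d + b + c + a
  regroup = solve-∀
  X-δ : ∀ r → δ (suc a) r * (δ b s * c) ≡ shift (λ r′ → δ a r′ * (δ b s * c)) r
  X-δ zero    = refl
  X-δ (suc r) = refl
  Y-δ : ∀ s → δ a r * (δ (suc b) s * c) ≡ shift (λ s′ → δ a r * (δ b s′ * c)) s
  Y-δ zero    = *-zeroʳ (δ a r)
  Y-δ (suc s) = refl
  YX-δ : ∀ r s → δ (suc a) r * (δ (suc b) s * c) ≡ shift (λ s′ → shift (λ r′ → δ a r′ * (δ b s′ * c)) r) s
  YX-δ zero    zero    = refl
  YX-δ zero    (suc s) = refl
  YX-δ (suc r) zero    = *-zeroʳ (δ a r)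
  YX-δ (suc r) (suc s) = refl
  easting : Step → ℕ → ℕ
  easting x a = proj₁ (move (a , 0) x)
  easting-last : ∀ (p : Path n) x → eastings (p ∷ʳ x) (suc n) ≡ easting x (eastings p n)
  easting-last p E = cong proj₁ (position-last p E)
  easting-last p N = cong proj₁ (position-last p N)
  -- The deltas pin the new eastings to r and s, so `bump` is first evaluated there. The weight then
  -- no longer depends on the last steps, and only the deltas are expressed by the old eastings.
  last : ∀ x y → f x y ≡ h (easting x a) (easting y b)
  last x y = begin
    f x y
      ≡⟨ cong (λ j → δ a′ r * (δ b′ s * g (bump a′ b′ j))) (meetings-∷ʳ p q x y n ℕ.≤-refl) ⟩
    δ a′ r * (δ b′ s * g (bump a′ b′ j))
      ≡⟨ δ-subst (λ u → δ b′ s * g (bump u b′ j)) a′ r ⟩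
    δ a′ r * (δ b′ s * g (bump r b′ j))
      ≡⟨ cong (λ u → δ a′ r * u) (δ-subst (λ u → g (bump r u j)) b′ s) ⟩
    δ a′ r * (δ b′ s * c)
      ≡⟨ cong₂ h (easting-last p x) (easting-last q y) ⟩
    h (easting x a) (easting y b) ∎
    where
    a′ b′ j : ℕ
    a′ = eastings (p ∷ʳ x) (suc n)
    b′ = eastings (q ∷ʳ y) (suc n)
    j  = meetings p q n

-- Whether the endpoints coincide depends only on r and s, so `bump r s` is absorbed into the weight
-- before A acts, and all neighbouring values share that weight. This is why the weight g is a
-- parameter.
W-step : ∀ g n r s → W[ g ] (suc n) r s ≡ A (W[ (λ j → g (bump r s j)) ] n) r s
W-step g n r s = begin
  sumOver (allPaths (suc n)) (λ p → sumOver (allPaths (suc n)) (f p))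
    ≡⟨ sum-allPaths-snoc n (λ p → sumOver (allPaths (suc n)) (f p)) ⟩
  sumOver (allPaths n) (λ p → sumOver (allPaths (suc n)) (f (p ∷ʳ E)) + sumOver (allPaths (suc n)) (f (p ∷ʳ N)))
    ≡⟨ sum-cong (allPaths n) (λ p → cong₂ _+_ (sum-allPaths-snoc n (f (p ∷ʳ E))) (sum-allPaths-snoc n (f (p ∷ʳ N)))) ⟩
  sumOver (allPaths n) (λ p → sumOver (allPaths n) (λ q → f (p ∷ʳ E) (q ∷ʳ E) + f (p ∷ʳ E) (q ∷ʳ N))
                            + sumOver (allPaths n) (λ q → f (p ∷ʳ N) (q ∷ʳ E) + f (p ∷ʳ N) (q ∷ʳ N)))
    ≡⟨ sum-cong (allPaths n) (λ p → sum-+ (allPaths n) _ _) ⟨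
  sumOver (allPaths n) (λ p → sumOver (allPaths n) (λ q →
    (f (p ∷ʳ E) (q ∷ʳ E) + f (p ∷ʳ E) (q ∷ʳ N)) + (f (p ∷ʳ N) (q ∷ʳ E) + f (p ∷ʳ N) (q ∷ʳ N))))
    ≡⟨ sum-cong (allPaths n) (λ p → sum-cong (allPaths n) (λ q → step-sum g p q r s)) ⟩
  sumOver (allPaths n) (λ p → sumOver (allPaths n) (λ q → A (h p q) r s))
    ≡⟨ sum-cong (allPaths n) (λ p → A.sum (allPaths n) (h p) r s) ⟨
  sumOver (allPaths n) (λ p → A (λ r′ s′ → sumOver (allPaths n) (λ q → h p q r′ s′)) r s)
    ≡⟨ A.sum (allPaths n) (λ p r′ s′ → sumOver (allPaths n) (λ q → h p q r′ s′)) r s ⟨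
  A (W[ (λ j → g (bump r s j)) ] n) r s ∎
  where
  f : Path (suc n) → Path (suc n) → ℤ
  f p q = δ (eastings p (suc n)) r * (δ (eastings q (suc n)) s * g (meetings p q (suc n)))
  h : Path n → Path n → Series₂
  h p q r′ s′ = δ (eastings p n) r′ * (δ (eastings q n) s′ * g (bump r s (meetings p q n)))

bump-≢ : ∀ {r s} j → r ≢ s → bump r s j ≡ j
bump-≢ {r} {s} j r≢s rewrite dec-false (r ℕ.≟ s) r≢s = refl

bump-≡ : ∀ r j → bump r r j ≡ suc j
bump-≡ r j rewrite dec-true (r ℕ.≟ r) refl = refl

W-ext : ∀ {g h} n → (∀ j → g j ≡ h j) → ∀ r s → W[ g ] n r s ≡ W[ h ] n r s
W-ext n eq r s = sum-cong (allPaths n) (λ p → sum-cong (allPaths n) (λ q →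
  cong (λ u → δ (eastings p n) r * (δ (eastings q n) s * u)) (eq (meetings p q n))))

W-off-diagonal : ∀ n k r s → r ≢ s → W (suc n) k r s ≡ A (W n k) r s
W-off-diagonal n k r s r≢s = trans (W-step (λ j → δ j k) n r s)
  (A.ext (W-ext n (λ j → cong (λ i → δ i k) (bump-≢ j r≢s))) r s)

-- A common endpoint is itself a meeting, which leaves k for the first n steps; `δ (suc j) (suc k)`
-- reduces to `δ j k`.
W-diagonal-suc : ∀ n k r → W (suc n) (suc k) r r ≡ A (W n k) r r
W-diagonal-suc n k r = trans (W-step (λ j → δ j (suc k)) n r r)
  (A.ext (W-ext n (λ j → cong (λ i → δ i (suc k)) (bump-≡ r j))) r r)

W-null : ∀ n r s → W[ (λ _ → 0ℤ) ] n r s ≡ 0ℤ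
W-null n r s = trans
  (sum-cong (allPaths n) (λ p → trans
    (sum-cong (allPaths n) (λ q → zeros (δ (eastings p n) r) (δ (eastings q n) s)))
    (sum-zero (allPaths n))))
  (sum-zero (allPaths n))
  where
  zeros : ∀ u v → u * (v * 0ℤ) ≡ 0ℤ
  zeros = solve-∀

W-diagonal-zero : ∀ n r → W (suc n) 0 r r ≡ 0ℤ
W-diagonal-zero n r = begin
  W (suc n) 0 r r                           ≡⟨ W-step (λ j → δ j 0) n r r ⟩
  A (W[ (λ j → δ (bump r r j) 0) ] n) r r   ≡⟨ A.ext (W-ext n (λ j → cong (λ i → δ i 0) (bump-≡ r j))) r r ⟩
  A (W[ (λ _ → 0ℤ) ] n) r r                 ≡⟨ A.ext (W-null n) r r ⟩
  A (λ _ _ → 0ℤ) r r                        ≡⟨ A.null r r ⟩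
  0ℤ                                        ∎

-- Comparison of M with W.

indicator-∧ : ∀ b c → indicator (b ∧ c) ≡ indicator b * indicator c
indicator-∧ true  c = sym (*-identityˡ (indicator c))
indicator-∧ false c = refl

-- The two counts treat only a common endpoint differently, and r ≢ s excludes one.
M≡W : ∀ n k r s → r ≢ s → + M (suc n) k r s ≡ W (suc n) k r s
M≡W n k r s r≢s = begin
  + M (suc n) k r s
    ≡⟨ length-filter (counted? (suc n) k r s) (cartesianProduct paths paths) ⟩
  sumOver (cartesianProduct paths paths) (λ z → indicator (does (counted? (suc n) k r s z)))
    ≡⟨ sum-cartesianProduct paths paths _ ⟩
  sumOver paths (λ p → sumOver paths (λ q → indicator (does (counted? (suc n) k r s (p , q)))))
    ≡⟨ sum-cong paths (λ p → sum-cong paths (λ q → weight p q)) ⟩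
  W (suc n) k r s ∎
  where
  paths : List (Path (suc n))
  paths = allPaths (suc n)
  weight : ∀ p q → indicator (does (counted? (suc n) k r s (p , q))) ≡
    δ (eastings p (suc n)) r * (δ (eastings q (suc n)) s * δ (meetings p q (suc n)) k)
  weight p q = begin
    indicator (does (counted? (suc n) k r s (p , q)))
      ≡⟨ indicator-∧ (does p-ends) (does q-ends ∧ does meets) ⟩
    indicator (does p-ends) * indicator (does q-ends ∧ does meets)
      ≡⟨ cong (λ u → indicator (does p-ends) * u) (indicator-∧ (does q-ends) (does meets)) ⟩
    indicator (does p-ends) * (indicator (does q-ends) * indicator (does meets))
      ≡⟨ cong₂ (λ u v → indicator u * (indicator v * indicator (does meets)))
           (does-⇔ (position≡ p (suc n) r ℕ.≤-refl) p-ends (a ℕ.≟ r))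
           (does-⇔ (position≡ q (suc n) s ℕ.≤-refl) q-ends (b ℕ.≟ s)) ⟩
    δ a r * (δ b s * δ (intersections p q) k)
      -- For length n + 1 the tested indices are 1 to n, hence `meetings` at n.
      ≡⟨ cong (λ i → δ a r * (δ b s * δ i k)) (meetings-filter p q n (ℕ.n≤1+n n)) ⟩
    δ a r * (δ b s * δ j k)
      -- The endpoint is now added: `bump r s` changes nothing, and the deltas turn it into the bump
      -- at the actual eastings.
      ≡⟨ cong (λ i → δ a r * (δ b s * δ i k)) (bump-≢ j r≢s) ⟨
    δ a r * (δ b s * δ (bump r s j) k)
      ≡⟨ cong (λ u → δ a r * u) (δ-subst (λ u → δ (bump r u j) k) b s) ⟨
    δ a r * (δ b s * δ (bump r b j) k)
      ≡⟨ δ-subst (λ u → δ b s * δ (bump u b j) k) a r ⟨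
    δ a r * (δ b s * δ (meetings p q (suc n)) k) ∎
    where
    p-ends = position p (suc n) ≟ₚ (r , suc n ∸ r)
    q-ends = position q (suc n) ≟ₚ (s , suc n ∸ s)
    meets  = intersections p q ℕ.≟ k
    a b j : ℕ
    a = eastings p (suc n)
    b = eastings q (suc n)
    j = meetings p q n

-- Symmetry and extreme values of W.

A-symmetric : ∀ {f} → (∀ r s → f r s ≡ f s r) → ∀ r s → A f r s ≡ A f s r
A-symmetric {f} f-sym r s = begin
  f r s + X f r s + Y f r s + Y (X f) r s
    ≡⟨ cong₂ _+_ (cong₂ _+_ (cong₂ _+_ (f-sym r s) (X≡Y r s)) (sym (X≡Y s r))) (YX r s) ⟩
  f s r + Y f s r + X f s r + Y (X f) s r
    ≡⟨ cong (λ u → u + Y (X f) s r) (swap (f s r) (Y f s r) (X f s r)) ⟩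
  f s r + X f s r + Y f s r + Y (X f) s r ∎
  where
  swap : ∀ a b c → a + b + c ≡ a + c + b
  swap = solve-∀
  X≡Y : ∀ r s → X f r s ≡ Y f s r
  X≡Y zero    s = refl
  X≡Y (suc r) s = f-sym r s
  YX : ∀ r s → Y (X f) r s ≡ Y (X f) s r
  YX zero    zero    = refl
  YX zero    (suc s) = refl
  YX (suc r) zero    = refl
  YX (suc r) (suc s) = f-sym r s

-- Off the diagonal the recursion inherits the symmetry of A. This gives access to the values with r
-- > s, which the comparison with `Q` does not cover.
W-symmetric : ∀ n k r s → W n k r s ≡ W n k s r
W-symmetric zero    k r s = swap (δ 0 r) (δ 0 s) (δ 0 k)
  where
  swap : ∀ a b c → (a * (b * c) + 0ℤ) + 0ℤ ≡ (b * (a * c) + 0ℤ) + 0ℤ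
  swap = solve-∀
W-symmetric (suc n) k r s with r ℕ.≟ s
... | yes refl = refl
... | no  r≢s  = begin
  W (suc n) k r s   ≡⟨ W-off-diagonal n k r s r≢s ⟩
  A (W n k) r s     ≡⟨ A-symmetric (W-symmetric n k) r s ⟩
  A (W n k) s r     ≡⟨ W-off-diagonal n k s r (λ eq → r≢s (sym eq)) ⟨
  W (suc n) k s r   ∎

A-null : ∀ {f} → (∀ r s → f r s ≡ 0ℤ) → ∀ r s → A f r s ≡ 0ℤ
A-null eq r s = trans (A.ext eq r s) (A.null r s)

-- Each step adds at most one meeting.
W-vanish : ∀ n k r s → n < k → W n k r s ≡ 0ℤ
W-vanish zero    (suc k) r s _ = zeros (δ 0 r) (δ 0 s)
  where
  zeros : ∀ a b → (a * (b * 0ℤ) + 0ℤ) + 0ℤ ≡ 0ℤ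
  zeros = solve-∀
W-vanish (suc n) (suc k) r s (s≤s n<k) with r ℕ.≟ s
... | yes refl = trans (W-diagonal-suc n k r) (A-null (λ r s → W-vanish n k r s n<k) r r)
... | no  r≢s  = trans (W-off-diagonal n (suc k) r s r≢s)
  (A-null (λ r s → W-vanish n (suc k) r s (ℕ.m≤n⇒m≤1+n n<k)) r s)

-- If the last of n + 1 steps is no meeting, all n + 1 meetings fall on the first n steps, which
-- `W-vanish` excludes.
W-always-off-diagonal : ∀ n r s → r ≢ s → W n n r s ≡ 0ℤ
W-always-off-diagonal zero    zero    zero    r≢s = contradiction refl r≢s
W-always-off-diagonal zero    zero    (suc s) _   = refl
W-always-off-diagonal zero    (suc r) s       _   = refl
W-always-off-diagonal (suc n) r       s       r≢s = trans (W-off-diagonal n (suc n) r s r≢s)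
  (A-null (λ r s → W-vanish n (suc n) r s ℕ.≤-refl) r s)

-- Only equal paths meet after every step, so this counts the paths with easting r. The two
-- off-diagonal neighbours vanish and Pascal's rule remains.
W-always : ∀ n r → W n n r r ≡ pow n r
W-always zero    zero    = refl
W-always zero    (suc r) = refl
W-always (suc n) zero    = trans (W-diagonal-suc n n 0) (cong (λ u → u + 0ℤ + 0ℤ + 0ℤ) (W-always n 0))
W-always (suc n) (suc r) = begin
  W (suc n) (suc n) (suc r) (suc r)
    ≡⟨ W-diagonal-suc n n (suc r) ⟩
  W n n (suc r) (suc r) + W n n r (suc r) + W n n (suc r) r + W n n r r
    ≡⟨ cong₂ _+_ (cong₂ _+_ (cong₂ _+_ (W-always n (suc r))
         (W-always-off-diagonal n r (suc r) (λ ()))) (W-always-off-diagonal n (suc r) r (λ ()))) (W-always n r) ⟩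
  pow n (suc r) + 0ℤ + 0ℤ + pow n r
    ≡⟨ cong (λ u → u + pow n r) (trans (+-identityʳ (pow n (suc r) + 0ℤ)) (+-identityʳ (pow n (suc r)))) ⟩
  pow n (suc r) + pow n r
    ≡⟨ pow-suc n (suc r) ⟨
  pow (suc n) (suc r) ∎

-- Identification of W with Q.

-- For r < s the four coefficients that A reads all lie in the region r ≤ s.
A-below : ∀ {f g} → (∀ r s → r ≤ s → f r s ≡ g r s) → ∀ r s → r < s → A f r s ≡ A g r s
A-below eq zero    (suc s) _ = cong₂ (λ u v → u + 0ℤ + v + 0ℤ) (eq 0 (suc s) z≤n) (eq 0 s z≤n)
A-below eq (suc r) (suc s) (s≤s r<s) = cong₂ _+_ (cong₂ _+_ (cong₂ _+_
  (eq (suc r) (suc s) (s≤s (ℕ.<⇒≤ r<s))) (eq r (suc s) (ℕ.m≤n⇒m≤1+n (ℕ.<⇒≤ r<s))))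
  (eq (suc r) s r<s)) (eq r s (ℕ.<⇒≤ r<s))

-- The base case m = 0. `W k k` lives on the diagonal, so above it A reaches only the line s = r +
-- 1, with the values of `Q-near`; beyond that line `Q-far` gives zero as well.
W-last : ∀ k r s → r < s → A (W k k) r s ≡ Q 0 k r s
W-last k zero    (suc zero)    _ = begin
  W k k 0 1 + 0ℤ + W k k 0 0 + 0ℤ
    ≡⟨ cong₂ (λ u v → u + 0ℤ + v + 0ℤ) (W-always-off-diagonal k 0 1 (λ ())) (W-always k 0) ⟩
  0ℤ + 0ℤ + pow k 0 + 0ℤ
    ≡⟨ Q-near k 0 ⟨
  Q 0 k 0 1 ∎
W-last k zero    (suc (suc s)) _ = trans
  (cong₂ (λ u v → u + 0ℤ + v + 0ℤ)
    (W-always-off-diagonal k 0 (suc (suc s)) (λ ())) (W-always-off-diagonal k 0 (suc s) (λ ())))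
  (sym (Q-far k 0 (suc (suc s)) (s≤s (s≤s z≤n))))
W-last k (suc r) (suc s) (s≤s r<s) = begin
  -- Of the four neighbours only the third, reached through y, can lie on the diagonal.
  W k k (suc r) (suc s) + W k k r (suc s) + W k k (suc r) s + W k k r s
    ≡⟨ cong₂ _+_ (cong₂ _+_ (cong₂ _+_
         (off (suc r) (suc s) (s≤s r<s)) (off r (suc s) (ℕ.m≤n⇒m≤1+n r<s))) refl) (off r s r<s) ⟩
  0ℤ + 0ℤ + W k k (suc r) s + 0ℤ
    ≡⟨ cong (λ u → 0ℤ + 0ℤ + u + 0ℤ) (diag (ℕ.m≤n⇒m<n∨m≡n r<s)) ⟩
  0ℤ + 0ℤ + Q 0 k (suc r) (suc s) + 0ℤ
    ≡⟨ zeros (Q 0 k (suc r) (suc s)) ⟩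
  Q 0 k (suc r) (suc s) ∎
  where
  zeros : ∀ u → 0ℤ + 0ℤ + u + 0ℤ ≡ u
  zeros = solve-∀
  off : ∀ r s → r < s → W k k r s ≡ 0ℤ
  off r s r<s = W-always-off-diagonal k r s (ℕ.<⇒≢ r<s)
  diag : suc r < s ⊎ suc r ≡ s → W k k (suc r) s ≡ Q 0 k (suc r) (suc s)
  diag (inj₁ far)  = trans (off (suc r) s far) (sym (Q-far k (suc r) (suc s) (s≤s far)))
  diag (inj₂ refl) = trans (W-always k (suc r)) (sym (Q-near k (suc r)))

-- B replaces the y of A by a second x. At a diagonal point the symmetry of f makes both
-- contributions equal, and after the exchange only coefficients with r ≤ s are read, where f and g
-- agree.
A≡B-diagonal : ∀ {f g} → (∀ r s → f r s ≡ f s r) → (∀ r s → r ≤ s → f r s ≡ g r s) →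
  ∀ r → A f r r ≡ B g r r
A≡B-diagonal f-sym eq zero    = cong (λ u → u + 0ℤ + 0ℤ + 0ℤ) (eq 0 0 z≤n)
A≡B-diagonal f-sym eq (suc r) = cong₂ _+_ (cong₂ _+_ (cong₂ _+_
  (eq (suc r) (suc r) ℕ.≤-refl) below) (trans (f-sym (suc r) r) below)) (eq r r ℕ.≤-refl)
  where below = eq r (suc r) (ℕ.n≤1+n r)

-- Off the diagonal the recursion lowers m and keeps k; on it, it lowers k and keeps m. The bases
-- are `W-last` for m = 0 and `Q-diagonal` for k = 0.
W≡Q : ∀ m k r s → r ≤ s → W (suc (m ℕ.+ k)) k r s ≡ Q m k r s
W≡Q m k r s r≤s with ℕ.m≤n⇒m<n∨m≡n r≤s
W≡Q zero    k       r s _ | inj₁ r<s  = trans (W-off-diagonal k k r s (ℕ.<⇒≢ r<s)) (W-last k r s r<s)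
W≡Q (suc m) k       r s _ | inj₁ r<s  = begin
  W (suc (suc m ℕ.+ k)) k r s   ≡⟨ W-off-diagonal (suc m ℕ.+ k) k r s (ℕ.<⇒≢ r<s) ⟩
  A (W (suc (m ℕ.+ k)) k) r s   ≡⟨ A-below (W≡Q m k) r s r<s ⟩
  A (Q m k) r s                 ≡⟨ Q-A m k r s ⟨
  Q (suc m) k r s               ∎
W≡Q m       zero    r r _ | inj₂ refl = trans (W-diagonal-zero (m ℕ.+ 0) r) (sym (Q-diagonal m r))
W≡Q m       (suc k) r r _ | inj₂ refl = begin
  W (suc (m ℕ.+ suc k)) (suc k) r r   ≡⟨ W-diagonal-suc (m ℕ.+ suc k) k r ⟩
  -- Length and number of meetings both drop by one, so m stays the same.
  A (W (m ℕ.+ suc k) k) r r           ≡⟨ cong (λ n → A (W n k) r r) (ℕ.+-suc m k) ⟩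
  A (W (suc (m ℕ.+ k)) k) r r         ≡⟨ A≡B-diagonal (W-symmetric (suc (m ℕ.+ k)) k) (W≡Q m k) r ⟩
  B (Q m k) r r                       ≡⟨ Q-B m k r r ⟨
  Q m (suc k) r r                     ∎

-- Return to binomial coefficients.

-- The coefficient is b over r - i, and reflection gives the lower entry i + b - r. For r < i that
-- entry exceeds b, so both sides vanish.
mono-binomial : ∀ i b r → r ≤ i ℕ.+ b → mono i b r ≡ pow b (i ℕ.+ b ∸ r)
mono-binomial zero    b r       r≤b       = cong +_ (nCk≡nC[n∸k] r≤b)
mono-binomial (suc i) b zero    _         = cong +_ (sym (k>n⇒nCk≡0 (s≤s (ℕ.m≤n+m b i))))
mono-binomial (suc i) b (suc r) (s≤s r≤n) = mono-binomial i b r r≤n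

summand : (n k r s i : ℕ) → ℤ
summand n k r s i =
  binom (+ k) (+ i) *
    ( binom (+ n - + k + + i - 1ℤ) (+ s - 1ℤ) * binom (+ n - + i - 1ℤ) (+ n - + r - 1ℤ)
    - binom (+ n - + k + + i - 1ℤ) (+ s) * binom (+ n - + i - 1ℤ) (+ n - + r) )

+-suc-∸ : ∀ {n i} → i ≤ n → + suc n - + i - 1ℤ ≡ + (n ∸ i)
+-suc-∸ {n} {i} i≤n = begin
  + suc n - + i - 1ℤ                ≡⟨ cong (λ u → + suc u - + i - 1ℤ) (ℕ.m+[n∸m]≡n i≤n) ⟨
  1ℤ + (+ i + + (n ∸ i)) - + i - 1ℤ ≡⟨ cancel (+ i) (+ (n ∸ i)) ⟩
  + (n ∸ i)                         ∎
  where
  cancel : ∀ i j → 1ℤ + (i + j) - i - 1ℤ ≡ j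
  cancel = solve-∀

-- With n = m + k + 1 the upper entries are a = m + i and b = m + k - i. Since i + b = n - 1, the
-- lower entries n - r - 1 and n - r are those of `mono-binomial` for i and i + 1.
summand-term : ∀ m k r s i → r ≤ m ℕ.+ k → i ≤ k →
  summand (suc (m ℕ.+ k)) k r (suc s) i ≡ pow k i * term i (m ℕ.+ i) (m ℕ.+ (k ∸ i)) r (suc s)
summand-term m k r s i r≤n i≤k = cong (λ u → pow k i * u) (begin
  binom (+ n - + k + + i - 1ℤ) (+ s) * binom (+ n - + i - 1ℤ) (+ n - + r - 1ℤ)
    - binom (+ n - + k + + i - 1ℤ) (+ suc s) * binom (+ n - + i - 1ℤ) (+ n - + r)
    ≡⟨ cong₂ (λ u v → binom u (+ s) * binom v (+ n - + r - 1ℤ) - binom u (+ suc s) * binom v (+ n - + r))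
         (cancel (+ m) (+ k) (+ i))
         (trans (+-suc-∸ (ℕ.≤-trans i≤k (ℕ.m≤n+m k m))) (cong +_ (ℕ.+-∸-assoc m i≤k))) ⟩
  pow a s * binom (+ b) (+ n - + r - 1ℤ) - pow a (suc s) * binom (+ b) (+ n - + r)
    ≡⟨ cong₂ (λ u v → pow a s * binom (+ b) u - pow a (suc s) * binom (+ b) v)
         (+-suc-∸ r≤n) (trans ([+m]-[+n]≡m⊖n n r) (⊖-≥ (ℕ.m≤n⇒m≤1+n r≤n))) ⟩
  pow a s * pow b (m ℕ.+ k ∸ r) - pow a (suc s) * pow b (suc (m ℕ.+ k) ∸ r)
    ≡⟨ cong₂ (λ u v → pow a s * pow b (u ∸ r) - pow a (suc s) * pow b (suc v ∸ r)) i+b i+b ⟨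
  pow a s * pow b (i ℕ.+ b ∸ r) - pow a (suc s) * pow b (suc (i ℕ.+ b) ∸ r)
    ≡⟨ cong₂ (λ u v → pow a s * u - pow a (suc s) * v)
         (mono-binomial i b r r≤i+b) (mono-binomial (suc i) b r (ℕ.m≤n⇒m≤1+n r≤i+b)) ⟨
  term i a b r (suc s) ∎)
  where
  n a b : ℕ
  n = suc (m ℕ.+ k)
  a = m ℕ.+ i
  b = m ℕ.+ (k ∸ i)
  cancel : ∀ m k i → 1ℤ + (m + k) - k + i - 1ℤ ≡ m + i
  cancel = solve-∀
  i+b : i ℕ.+ b ≡ m ℕ.+ k
  i+b = begin
    i ℕ.+ (m ℕ.+ (k ∸ i))   ≡⟨ ℕ.+-comm i b ⟩
    m ℕ.+ (k ∸ i) ℕ.+ i     ≡⟨ ℕ.+-assoc m (k ∸ i) i ⟩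
    m ℕ.+ (k ∸ i ℕ.+ i)     ≡⟨ cong (m ℕ.+_) (ℕ.m∸n+n≡m i≤k) ⟩
    m ℕ.+ k                 ∎
  r≤i+b : r ≤ i ℕ.+ b
  r≤i+b = subst (r ≤_) (sym i+b) r≤n

-- Vanishing of the formula for k ≥ n.

-- A nonzero product would need a ≥ p and b ≥ q. The slack `suc t` expresses a + b < p + q as an
-- equation that a ring solver can check.
binom-product-zero : ∀ a b p q t → a + b + + suc t ≡ + (p ℕ.+ q) → binom a (+ p) * binom b (+ q) ≡ 0ℤ
binom-product-zero -[1+ a ] b        p q t eq = refl
binom-product-zero (+ a)    -[1+ b ] p q t eq = *-zeroʳ (pow a p)
binom-product-zero (+ a)    (+ b)    p q t eq with a ℕ.<? p | b ℕ.<? q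
... | yes a<p | _       = cong (λ c → + c * pow b q) (k>n⇒nCk≡0 a<p)
... | no  _   | yes b<q = trans (cong (λ c → pow a p * + c) (k>n⇒nCk≡0 b<q)) (*-zeroʳ (pow a p))
... | no  a≮p | no  b≮q = contradiction (ℕ.+-mono-≤ (ℕ.≮⇒≥ a≮p) (ℕ.≮⇒≥ b≮q))
  (ℕ.<⇒≱ (subst (a ℕ.+ b <_) (+-injective eq) (ℕ.m<m+n (a ℕ.+ b) (s≤s z≤n))))

-- The upper entries sum to n - c - 2, independently of i. The lower ones sum to n + d - 1 in the
-- first product and n + d + 1 in the second, so the slacks are d + c + 1 and d + c + 3.
summand-zero : ∀ r d e c i → let s = suc (r ℕ.+ d); n = s ℕ.+ e in summand n (n ℕ.+ c) r s i ≡ 0ℤ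
summand-zero r d e c i = begin
  binom (+ k) (+ i) * (binom a (+ (r ℕ.+ d)) * binom b (+ n - + r - 1ℤ) - binom a (+ s) * binom b (+ n - + r))
    ≡⟨ cong₂ (λ u v → binom (+ k) (+ i) * (binom a (+ (r ℕ.+ d)) * binom b u - binom a (+ s) * binom b v))
         (low (+ r) (+ d) (+ e)) (high (+ r) (+ d) (+ e)) ⟩
  binom (+ k) (+ i) * (binom a (+ (r ℕ.+ d)) * binom b (+ (d ℕ.+ e)) - binom a (+ s) * binom b (+ suc (d ℕ.+ e)))
    ≡⟨ cong₂ (λ u v → binom (+ k) (+ i) * (u - v))
         (binom-product-zero a b (r ℕ.+ d) (d ℕ.+ e) (d ℕ.+ c)
           (sum-low (+ r) (+ d) (+ e) (+ c) (+ i)))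
         (binom-product-zero a b s (suc (d ℕ.+ e)) (2 ℕ.+ (d ℕ.+ c))
           (sum-high (+ r) (+ d) (+ e) (+ c) (+ i))) ⟩
  binom (+ k) (+ i) * 0ℤ
    ≡⟨ *-zeroʳ (binom (+ k) (+ i)) ⟩
  0ℤ ∎
  where
  s n k : ℕ
  s = suc (r ℕ.+ d)
  n = s ℕ.+ e
  k = n ℕ.+ c
  a b : ℤ
  a = + n - + k + + i - 1ℤ
  b = + n - + i - 1ℤ
  low : ∀ r d e → 1ℤ + (r + d) + e - r - 1ℤ ≡ d + e
  low = solve-∀
  high : ∀ r d e → 1ℤ + (r + d) + e - r ≡ 1ℤ + (d + e)
  high = solve-∀
  sum-low : ∀ r d e c i → let n = 1ℤ + (r + d) + e in
    (n - (n + c) + i - 1ℤ) + (n - i - 1ℤ) + (1ℤ + (d + c)) ≡ (r + d) + (d + e)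
  sum-low = solve-∀
  sum-high : ∀ r d e c i → let n = 1ℤ + (r + d) + e in
    (n - (n + c) + i - 1ℤ) + (n - i - 1ℤ) + (1ℤ + (1ℤ + (1ℤ + (d + c)))) ≡ (1ℤ + (r + d)) + (1ℤ + (d + e))
  sum-high = solve-∀

theorem5 : ∀ (n k r s : ℕ) → 1 ≤ n → r < s → s ≤ n →
    + M n k r s ≡
    ∑[0… k ] (λ i →
    binom (+ k) (+ i) *
    ( binom (+ n - + k + + i - 1ℤ) (+ s - 1ℤ) * binom (+ n - + i - 1ℤ) (+ n - + r - 1ℤ)
    - binom (+ n - + k + + i - 1ℤ) (+ s) * binom (+ n - + i - 1ℤ) (+ n - + r) ))
-- Here n is the length minus one, so k ≤ n is exactly the range in which m = n - k exists.
theorem5 (suc n) k r s _ r<s s≤n with k ℕ.≤? n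
theorem5 (suc n) k r (suc s) _ r<s (s≤s s≤n) | yes k≤n = begin
  + M (suc n) k r (suc s)
    ≡⟨ M≡W n k r (suc s) (ℕ.<⇒≢ r<s) ⟩
  W (suc n) k r (suc s)
    ≡⟨ cong (λ n → W (suc n) k r (suc s)) m+k≡n ⟨
  W (suc (n ∸ k ℕ.+ k)) k r (suc s)
    ≡⟨ W≡Q (n ∸ k) k r (suc s) (ℕ.<⇒≤ r<s) ⟩
  Q (n ∸ k) k r (suc s)
    ≡⟨ sum-upTo-cong (suc k) (λ { i (s≤s i≤k) → summand-term (n ∸ k) k r s i
         (subst (r ≤_) (sym m+k≡n) (ℕ.≤-trans (ℕ.s≤s⁻¹ r<s) s≤n)) i≤k }) ⟨
  sumOver (upTo (suc k)) (summand (suc (n ∸ k ℕ.+ k)) k r (suc s))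
    ≡⟨ cong (λ n → sumOver (upTo (suc k)) (summand (suc n) k r (suc s))) m+k≡n ⟩
  sumOver (upTo (suc k)) (summand (suc n) k r (suc s)) ∎
  where
  m+k≡n : n ∸ k ℕ.+ k ≡ n
  m+k≡n = ℕ.m∸n+n≡m k≤n
-- Differences d, e and c turn r < s, s ≤ n + 1 and n < k into equations, the form in which
-- `summand-zero` is stated.
... | no k≰n with ℕ.m≤n⇒∃[o]m+o≡n r<s | ℕ.m≤n⇒∃[o]m+o≡n s≤n | ℕ.m≤n⇒∃[o]m+o≡n (ℕ.≰⇒> k≰n)
... | d , refl | e , refl | c , refl = begin
  + M (suc n) k r s
    ≡⟨ M≡W n k r s (ℕ.<⇒≢ r<s) ⟩
  W (suc n) k r s
    ≡⟨ W-off-diagonal n k r s (ℕ.<⇒≢ r<s) ⟩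
  A (W n k) r s
    ≡⟨ A-null (λ r s → W-vanish n k r s (ℕ.≰⇒> k≰n)) r s ⟩
  0ℤ
    ≡⟨ sum-zero (upTo (suc k)) ⟨
  sumOver (upTo (suc k)) (λ _ → 0ℤ)
    ≡⟨ sum-cong (upTo (suc k)) (summand-zero r d e c) ⟨
  sumOver (upTo (suc k)) (summand (suc n) k r s) ∎
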